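{- For every integer $w>1$, $$\operatorname{olws}_R(w)\;\ge\;\left\lceil \tfrac{3}{2}w\right\rceil,$$ where $\operatorname{olws}_R(w)$ denotes the on-line width of the class of semi-orders of width at most $w$ presented with (unit-interval) representation.
   Context: Semi-orders with representation. A finite sequence of closed unit-length intervals $[r_1-1,r_1],\ldots,[r_n-1,r_n]$ on the real line (repetitions of the same interval are allowed, and different indices are different elements) represents the poset on elements $x_1,\ldots,x_n$ in which $x_i<x_j$ if and only if $r_i<r_j-1$; thus two distinct elements are incomparable exactly when their intervals intersect. Posets arising in this way are called semi-orders. The width of a poset is the maximum size of an antichain. On-line chain partitioning game. Fix a positive integer $w$. In round $i$ the presenter introduces an element $x_i$ by giving a closed unit interval $[r_i-1,r_i]$ (i.e. the real number $r_i$), such that the semi-order represented by all intervals presented so far has width at most $w$. The (deterministic) on-line algorithm must then immediately and irrevocably assign $x_i$ to a chain, i.e. give it a chain label such that all elements with the same label are pairwise comparable (their intervals are pairwise disjoint). The assignment may depend only on the intervals presented so far and on the chains to which the earlier elements were assigned. The presenter may choose each interval depending on the algorithm's previous assignments. The number of chains used is the number of distinct labels used. On-line width. $\operatorname{olws}_R(w)$ is the largest integer $k$ for which there exists a strategy of the presenter that forces any on-line algorithm to use (at least) $k$ chains on a semi-order of width at most $w$ presented in this way as unit intervals. -}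

module Defs where

open import Data.Fin using (Fin)
open import Data.Fin.Subset using (Subset; _∈_; ∣_∣)
open import Data.List using (List; []; _∷_; length; lookup; map; deduplicate)
open import Data.Nat as ℕ using (ℕ; zero; suc)
open import Data.Product using (_×_; _,_; ∃-syntax; proj₁; proj₂)
open import Data.Rational using (ℚ; 1ℚ; -_; _+_; _<_)
open import Data.Rational.Properties
  using (+-assoc; +-identityʳ; +-inverseˡ; +-inverseʳ; +-monoˡ-<)
open import Data.Sum using (_⊎_)
open import Level using (0ℓ)
open import Relation.Binary using (Rel)
open import Relation.Binary.PropositionalEquality
  using (_≡_; _≢_; sym; trans; cong; subst)
open import Relation.Nullary using (¬_)

-- Real numbers as two-sided (located) Dedekind cuts of ℚ: `lower q` means
-- q < x and `upper q` means x < q.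

record ℝ : Set₁ where
  field
    lower upper     : ℚ → Set
    lower-inhabited : ∃[ q ] lower q
    upper-inhabited : ∃[ q ] upper q
    lower-closed    : ∀ {p q} → p < q → lower q → lower p
    upper-closed    : ∀ {p q} → p < q → upper p → upper q
    lower-open      : ∀ {p} → lower p → ∃[ q ] (p < q × lower q)
    upper-open      : ∀ {q} → upper q → ∃[ p ] (p < q × upper p)
    disjoint        : ∀ {q} → ¬ (lower q × upper q)
    located         : ∀ {p q} → p < q → lower p ⊎ upper q

open ℝ public

infix 4 _<ᴿ_

_<ᴿ_ : ℝ → ℝ → Set
x <ᴿ y = ∃[ q ] (upper x q × lower y q)

private
  -1+1 : ∀ q → (q + - 1ℚ) + 1ℚ ≡ q
  -1+1 q = trans (+-assoc q (- 1ℚ) 1ℚ)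
          (trans (cong (q +_) (+-inverseˡ 1ℚ)) (+-identityʳ q))

  +1-1 : ∀ q → (q + 1ℚ) + - 1ℚ ≡ q
  +1-1 q = trans (+-assoc q 1ℚ (- 1ℚ))
          (trans (cong (q +_) (+-inverseʳ 1ℚ)) (+-identityʳ q))

-- x minus one, using q < x - 1 iff q + 1 < x, and x - 1 < q iff x < q + 1.
infix 8 _-1ᴿ

_-1ᴿ : ℝ → ℝ
lower (x -1ᴿ) q = lower x (q + 1ℚ)
upper (x -1ᴿ) q = upper x (q + 1ℚ)
lower-inhabited (x -1ᴿ) with lower-inhabited x
... | q , l = q + - 1ℚ , subst (lower x) (sym (-1+1 q)) l
upper-inhabited (x -1ᴿ) with upper-inhabited x
... | q , u = q + - 1ℚ , subst (upper x) (sym (-1+1 q)) u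
lower-closed (x -1ᴿ) p<q = lower-closed x (+-monoˡ-< 1ℚ p<q)
upper-closed (x -1ᴿ) p<q = upper-closed x (+-monoˡ-< 1ℚ p<q)
lower-open (x -1ᴿ) {p} l with lower-open x l
... | q , p+1<q , l′ = q + - 1ℚ
    , subst (_< q + - 1ℚ) (+1-1 p) (+-monoˡ-< (- 1ℚ) p+1<q)
    , subst (lower x) (sym (-1+1 q)) l′
upper-open (x -1ᴿ) {q} u with upper-open x u
... | p , p<q+1 , u′ = p + - 1ℚ
    , subst (p + - 1ℚ <_) (+1-1 q) (+-monoˡ-< (- 1ℚ) p<q+1)
    , subst (upper x) (sym (-1+1 p)) u′
disjoint (x -1ᴿ) = disjoint x
located (x -1ᴿ) p<q = located x (+-monoˡ-< 1ℚ p<q)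

-- The semi-order represented by the intervals [ r i - 1 , r i ]. Its elements are
-- the indices, so equal intervals at different indices are different elements.

SemiOrder : ∀ {n} → (Fin n → ℝ) → Rel (Fin n) 0ℓ
SemiOrder r i j = r i <ᴿ r j -1ᴿ

module _ {n : ℕ} (_≺_ : Rel (Fin n) 0ℓ) where

  Comparable : Rel (Fin n) 0ℓ
  Comparable i j = i ≺ j ⊎ j ≺ i

  Antichain : Subset n → Set
  Antichain S = ∀ {i j} → i ∈ S → j ∈ S → i ≢ j → ¬ Comparable i j

  WidthAtMost : ℕ → Set
  WidthAtMost w = ∀ S → Antichain S → ∣ S ∣ ℕ.≤ w

-- A history lists the real r presented and the chain label assigned in each
-- round, latest round first.

Label : Set
Label = ℕ

History : Set₁
History = List (ℝ × Label)

labels : History → List Label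
labels = map proj₂

Presented : (h : History) → Rel (Fin (length h)) 0ℓ
Presented h = SemiOrder (λ i → proj₁ (lookup h i))

ChainPartition : History → Set
ChainPartition h = ∀ i j → i ≢ j →
  proj₂ (lookup h i) ≡ proj₂ (lookup h j) → Comparable (Presented h) i j

chainsUsed : History → ℕ
chainsUsed h = length (deduplicate ℕ._≟_ (labels h))

-- A presenter sees the labels assigned so far (latest first); the intervals
-- presented so far are determined by those labels and the strategy.
Presenter : Set₁
Presenter = List Label → ℝ

-- An algorithm sees the history and the newly presented interval.
Algorithm : Set₁
Algorithm = History → ℝ → Label

play : Presenter → Algorithm → ℕ → History
play σ A zero    = []
play σ A (suc n) = (r , A h r) ∷ h
  where
  h : History
  h = play σ A n
  r : ℝ
  r = σ (labels h)

-- The presenter may stop after any finite number n of rounds, depending on the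
-- algorithm. Both rules of the game are inherited by sub-histories, so asking
-- for them after n rounds asks for them after every earlier round as well.
-- `Algorithm` contains arbitrary functions; one which breaks the rules during
-- the play against σ is not an on-line chain partitioning algorithm, and nothing
-- is required against it beyond the width bound. Rule-following is demanded only
-- on this play: demanding it on all inputs would, constructively, exclude
-- algorithms that compare real numbers, as that comparison is undecidable.
Forces : (w : ℕ) → Presenter → (k : ℕ) → Set₁
Forces w σ k = ∀ (A : Algorithm) → ∃[ n ]
  ( WidthAtMost (Presented (play σ A n)) w
  × (ChainPartition (play σ A n) → k ℕ.≤ chainsUsed (play σ A n)))

CanForce : (w k : ℕ) → Set₁
CanForce w k = ∃[ σ ] Forces w σ k

-- `k is the on-line width olws_R(w)`.
IsOlwsR : (w k : ℕ) → Set₁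
IsOlwsR w k = CanForce w k × (∀ m → CanForce w m → m ℕ.≤ k)

-- `olws_R(w) ≥ b`. The largest k need not be computable, so the bound is stated
-- both for the set of k over which the maximum is taken (some element of it is
-- at least b) and for the maximum itself.
OlwsR≥ : (w b : ℕ) → Set₁
OlwsR≥ w b =
    (∃[ k ] (CanForce w k × b ℕ.≤ k))
  × (∀ k → IsOlwsR w k → b ℕ.≤ k)

{-# OPTIONS --safe #-}

-- All right endpoints lie in three clusters, at s, s + 1 and s + 2 with 0 < s < 1.
-- Each cluster is a clique, the outer two do not meet, and the middle point with
-- offset t meets the left points with offset ≥ t and the right points with offset ≤ t.
-- Let k = ⌊w/2⌋. The presenter stacks k left points C, then plays right points into
-- a gap which shrinks from the right when a label of C is repeated (O) and from the
-- left otherwise, until there are k points N with labels not in C. If w = 2k, then k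
-- middle points in the gap meet all of C and N but no point of O: 3k labels.
--
-- If w = 2k + 1, the presenter goes on with left points in the gap, pushing it from
-- the left as long as a label of N is repeated (B), until a point z has a label not
-- in N, and with right points beyond z until a point y has a label not in C. Then
-- k + 1 middle points are played strictly between z and y, where they meet C and N but
-- neither z nor y. Once one of them takes the label of z, the rest are played at y,
-- so that they avoid the label of y; once one takes the label of y, the rest are
-- played at z. If z and y have the same label, k middle points are played at z and one
-- at y. In all cases the labels of C, N, the middle points and one of z and y are
-- pairwise distinct: 3k + 2 labels.
module Submission where

open import Defs
open import Data.Empty using (⊥)
open import Data.Fin as Fin using (Fin; zero; suc)
open import Data.Fin.Properties using (any?)
open import Data.Fin.Subset using (Subset; ∣_∣; inside; outside)
import Data.Fin.Subset as Subset
import Data.Fin.Subset.Properties as Subset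
import Data.Nat.Properties as ℕ
open import Data.Integer using (+_)
open import Data.List using (List; []; _∷_; _++_; length; lookup; map; filter; _ʳ++_)
open import Data.List.Membership.Propositional using (_∈_; _∉_)
open import Data.List.Membership.Propositional.Properties
  using (∈-map⁺; ∈-map⁻; ∈-++⁺ˡ; ∈-++⁺ʳ; ∈-++⁻; ∈-∃++; ∈-deduplicate⁺)
open import Data.List.Membership.DecPropositional ℕ._≟_ using (_∈?_)
open import Data.List.Properties
  using (map-∘; map-++; length-++; length-map; length-filter; filter-none; filter-reject; filter-++)
open import Data.List.Relation.Binary.Permutation.Propositional
  using (_↭_; ↭-refl; ↭-sym; ↭-trans; prep)
open import Data.List.Relation.Binary.Permutation.Propositional.Properties
  using (shift; filter-↭; ↭-length; ∈-resp-↭; All-resp-↭) renaming (map⁺ to ↭-map⁺; ++⁺ˡ to ↭-++⁺ˡ)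
open import Data.List.Relation.Binary.Subset.Propositional using (_⊆_)
open import Data.List.Relation.Unary.All as All using (All; []; _∷_; all?)
open import Data.List.Relation.Unary.All.Properties using (¬Any⇒All¬)
open import Data.List.Relation.Unary.AllPairs using ([]; _∷_)
open import Data.List.Relation.Unary.Any using (here; there)
open import Data.List.Relation.Unary.Unique.Propositional using (Unique)
open import Data.Nat using (ℕ; zero; suc; _+_; _∸_; _≤_; _<_; _*_; ⌈_/2⌉; z≤n; s≤s)
open import Data.Nat.Solver using (module +-*-Solver)
open import Data.Product using (_×_; _,_; ∃-syntax; proj₁; proj₂)
open import Data.Rational as ℚ using (ℚ; 0ℚ; 1ℚ)
import Data.Rational.Properties as ℚ
open import Data.Sum using (_⊎_; inj₁; inj₂; [_,_]′)
import Data.Sum as Sum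
open import Data.Unit using (⊤; tt)
open import Data.Vec using ([]; _∷_; here; there)
open import Function using (_∘_; id; case_of_)
open import Level using (0ℓ)
open import Relation.Binary.PropositionalEquality
  using (_≡_; _≢_; refl; sym; trans; cong; subst; subst₂)
open import Relation.Nullary using (¬_; Dec; yes; no; contradiction; _⊎-dec_; _×-dec_; _→-dec_)
open import Relation.Nullary.Decidable using (True; toWitness; from-yes)
open import Relation.Unary using (Pred; Decidable)

-- Counting distinct labels.

Unique-⊆⇒length≤ : {A : Set} {xs ys : List A} → Unique xs → xs ⊆ ys → length xs ≤ length ys
Unique-⊆⇒length≤ [] _ = z≤n
Unique-⊆⇒length≤ {xs = x ∷ xs} (x∉xs ∷ xs!) xs⊆ys
  with as , bs , refl ← ∈-∃++ (xs⊆ys (here refl)) = begin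
    suc (length xs)         ≤⟨ s≤s (Unique-⊆⇒length≤ xs! avoid) ⟩
    suc (length (as ++ bs)) ≡⟨ ↭-length (shift x as bs) ⟨
    length (as ++ x ∷ bs)   ∎
  where
  open ℕ.≤-Reasoning
  avoid : xs ⊆ as ++ bs
  avoid v∈xs with ∈-resp-↭ (shift x as bs) (xs⊆ys (there v∈xs))
  ... | here refl = contradiction refl (All.lookup x∉xs v∈xs)
  ... | there v∈  = v∈

Unique⇒length≤chainsUsed : ∀ h {L} → Unique L → L ⊆ labels h → length L ≤ chainsUsed h
Unique⇒length≤chainsUsed h L! L⊆ = Unique-⊆⇒length≤ L! (∈-deduplicate⁺ ℕ._≟_ ∘ L⊆)

-- Strategies as game trees

module _ (w K : ℕ) where

  -- An inductive tree, so every play against it ends although the number of rounds depends on the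
  -- algorithm. It branches over all labels, legal or not, and thus mentions no algorithm.
  data Winning (h : History) : Set₁ where
    stop    : WidthAtMost (Presented h) w →
              (ChainPartition h → K ≤ chainsUsed h) → Winning h
    present : (r : ℝ) → (∀ c → Winning ((r , c) ∷ h)) → Winning h

  private
    move : ∀ {h} → ℝ → Winning h → List Label → ℝ
    -- A presenter must answer every list of labels; beyond a leaf the answer `d` is arbitrary.
    move d (stop _ _)    _        = d
    move d (present r _) []       = r
    move d (present _ t) (c ∷ cs) = move d (t c) cs

  Winning⇒CanForce : ℝ → Winning [] → CanForce w K
  Winning⇒CanForce d t₀ = σ , λ A → follow A 0 refl t₀ λ _ → refl
    where
    σ : Presenter
    -- Labels arrive latest first, but the tree is descended from its root.
    σ ls = move d t₀ (ls ʳ++ [])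

    -- The last hypothesis says that the labels of `h` lead from the root to the subtree `t`.
    -- Keeping `cs` general lets it pass to a child: the next label simply moves to the front of
    -- `cs`.
    follow : ∀ A n {h} → play σ A n ≡ h → (t : Winning h) →
             (∀ cs → move d t₀ (labels h ʳ++ cs) ≡ move d t cs) →
             ∃[ m ] (WidthAtMost (Presented (play σ A m)) w
               × (ChainPartition (play σ A m) → K ≤ chainsUsed (play σ A m)))
    follow A n refl (stop width enough) _ = n , width , enough
    follow A n {h} refl (present r t) eq =
      follow A (suc n) (cong (λ q → (q , A h q) ∷ h) (eq [])) (t (A h r)) λ cs → eq (A h r ∷ cs)

-- Points in three clusters, and their antichains

fromℚ : ℚ → ℝ
fromℚ x .lower q = q ℚ.< x
fromℚ x .upper q = x ℚ.< q
fromℚ x .lower-inhabited = x ℚ.- 1ℚ ,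
  subst (x ℚ.- 1ℚ ℚ.<_) (ℚ.+-identityʳ x) (ℚ.+-monoʳ-< x (ℚ.negative⁻¹ (ℚ.- 1ℚ)))
fromℚ x .upper-inhabited = x ℚ.+ 1ℚ ,
  subst (ℚ._< x ℚ.+ 1ℚ) (ℚ.+-identityʳ x) (ℚ.+-monoʳ-< x (ℚ.positive⁻¹ 1ℚ))
fromℚ x .lower-closed = ℚ.<-trans
fromℚ x .upper-closed p<q x<p = ℚ.<-trans x<p p<q
fromℚ x .lower-open p<x with m , p<m , m<x ← ℚ.<-dense p<x = m , p<m , m<x
fromℚ x .upper-open x<q with m , x<m , m<q ← ℚ.<-dense x<q = m , m<q , x<m
fromℚ x .disjoint (q<x , x<q) = ℚ.<-asym q<x x<q
fromℚ x .located {p} p<q with p ℚ.<? x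
... | yes p<x = inj₁ p<x
... | no  p≮x = inj₂ (ℚ.≤-<-trans (ℚ.≮⇒≥ p≮x) p<q)

ℚ-<⇒≱ : ∀ {p q} → p ℚ.< q → ¬ q ℚ.≤ p
ℚ-<⇒≱ p<q q≤p = ℚ.<-irrefl refl (ℚ.<-≤-trans p<q q≤p)

+-cancelʳ-< : ∀ r {p q} → p ℚ.+ r ℚ.< q ℚ.+ r → p ℚ.< q
+-cancelʳ-< r p+r<q+r = ℚ.≰⇒> λ q≤p → ℚ-<⇒≱ p+r<q+r (ℚ.+-monoˡ-≤ r q≤p)

fromℚ-<⁺ : ∀ {x y} → x ℚ.+ 1ℚ ℚ.< y → fromℚ x <ᴿ fromℚ y -1ᴿ
fromℚ-<⁺ {x} {y} x+1<y with m , x+1<m , m<y ← ℚ.<-dense x+1<y =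
  m ℚ.- 1ℚ , +-cancelʳ-< 1ℚ (subst (x ℚ.+ 1ℚ ℚ.<_) (sym m-1+1) x+1<m) ,
  subst (ℚ._< y) (sym m-1+1) m<y
  where
  m-1+1 : m ℚ.- 1ℚ ℚ.+ 1ℚ ≡ m
  m-1+1 = trans (ℚ.+-assoc m (ℚ.- 1ℚ) 1ℚ) (trans (cong (m ℚ.+_) (ℚ.+-inverseˡ 1ℚ)) (ℚ.+-identityʳ m))

fromℚ-<⁻ : ∀ {x y} → fromℚ x <ᴿ fromℚ y -1ᴿ → x ℚ.+ 1ℚ ℚ.< y
fromℚ-<⁻ (q , x<q , q+1<y) = ℚ.<-trans (ℚ.+-monoˡ-< 1ℚ x<q) q+1<y

-- Offsets, clusters and comparability of points.

record Offset : Set where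
  field
    value   : ℚ
    above-0 : 0ℚ ℚ.< value
    below-1 : value ℚ.< 1ℚ

open Offset

infix 4 _≺_ _≼_

_≺_ _≼_ : Offset → Offset → Set
s ≺ t = value s ℚ.< value t
s ≼ t = value s ℚ.≤ value t

≺-dense : ∀ {s t} → s ≺ t → ∃[ m ] (s ≺ m × m ≺ t)
≺-dense {s} {t} s≺t with m , s<m , m<t ← ℚ.<-dense s≺t =
  record { value = m ; above-0 = ℚ.<-trans (above-0 s) s<m ; below-1 = ℚ.<-trans m<t (below-1 t) } ,
  s<m , m<t

data Cluster : Set where
  left middle right : Cluster

Point : Set
Point = Cluster × Offset

position : Point → ℚ
position (left   , s) = value s
position (middle , s) = value s ℚ.+ 1ℚ
position (right  , s) = value s ℚ.+ 1ℚ ℚ.+ 1ℚ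

infix 4 _⊲_ _⊲?_

-- The semi-order on points, with positions replaced by a comparison of offsets; `⊲⇒+1<` and `+1<⇒⊲`
-- show the agreement. The bounds on offsets decide the pairs whose clusters are equal or not
-- adjacent.
_⊲_ : Point → Point → Set
(left   , s) ⊲ (middle , t) = s ≺ t
(middle , s) ⊲ (right  , t) = s ≺ t
(left   , _) ⊲ (right  , _) = ⊤
_            ⊲ _            = ⊥

_⊲?_ : ∀ p q → Dec (p ⊲ q)
(left   , _) ⊲? (left   , _) = no id
(left   , s) ⊲? (middle , t) = value s ℚ.<? value t
(left   , _) ⊲? (right  , _) = yes tt
(middle , _) ⊲? (left   , _) = no id
(middle , _) ⊲? (middle , _) = no id
(middle , s) ⊲? (right  , t) = value s ℚ.<? value t
(right  , _) ⊲? (left   , _) = no id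
(right  , _) ⊲? (middle , _) = no id
(right  , _) ⊲? (right  , _) = no id

private
  off+1≮off : ∀ s t → ¬ value s ℚ.+ 1ℚ ℚ.< value t
  off+1≮off s t lt = ℚ.<-asym (ℚ.<-trans lt (below-1 t))
    (subst (ℚ._< value s ℚ.+ 1ℚ) (ℚ.+-identityˡ 1ℚ) (ℚ.+-monoˡ-< 1ℚ (above-0 s)))

  <+1 : ∀ p → p ℚ.< p ℚ.+ 1ℚ
  <+1 p = fromℚ p .upper-inhabited .proj₂

⊲⇒+1< : ∀ p q → p ⊲ q → position p ℚ.+ 1ℚ ℚ.< position q
⊲⇒+1< (left   , s) (middle , t) = ℚ.+-monoˡ-< 1ℚ
⊲⇒+1< (left   , s) (right  , t) _ = ℚ.+-monoˡ-< 1ℚ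
  (ℚ.<-trans (below-1 s) (subst (ℚ._< value t ℚ.+ 1ℚ) (ℚ.+-identityˡ 1ℚ) (ℚ.+-monoˡ-< 1ℚ (above-0 t))))
⊲⇒+1< (middle , s) (right  , t) = ℚ.+-monoˡ-< 1ℚ ∘ ℚ.+-monoˡ-< 1ℚ

+1<⇒⊲ : ∀ p q → position p ℚ.+ 1ℚ ℚ.< position q → p ⊲ q
+1<⇒⊲ (left   , s) (left   , t) lt = off+1≮off s t lt
+1<⇒⊲ (left   , s) (middle , t) lt = +-cancelʳ-< 1ℚ lt
+1<⇒⊲ (left   , s) (right  , t) lt = tt
+1<⇒⊲ (middle , s) (left   , t) lt = off+1≮off s t (ℚ.<-trans (<+1 _) lt)
+1<⇒⊲ (middle , s) (middle , t) lt = off+1≮off s t (+-cancelʳ-< 1ℚ lt)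
+1<⇒⊲ (middle , s) (right  , t) lt = +-cancelʳ-< 1ℚ (+-cancelʳ-< 1ℚ lt)
+1<⇒⊲ (right  , s) (left   , t) lt = off+1≮off s t (ℚ.<-trans (<+1 _) (ℚ.<-trans (<+1 _) lt))
+1<⇒⊲ (right  , s) (middle , t) lt = off+1≮off s t (ℚ.<-trans (<+1 _) (+-cancelʳ-< 1ℚ lt))
+1<⇒⊲ (right  , s) (right  , t) lt = off+1≮off s t (+-cancelʳ-< 1ℚ (+-cancelʳ-< 1ℚ lt))

-- Histories made of rational points.

Entry : Set
Entry = Point × Label

round : Entry → ℝ × Label
round (p , c) = fromℚ (position p) , c

history : List Entry → History
history = map round

-- Indexed by the length of the presented history, so that a subset of its elements picks out
-- entries of `G` without a change of index type.
entry : ∀ G → Fin (length (history G)) → Entry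
entry (e ∷ G) zero    = e
entry (e ∷ G) (suc i) = entry G i

point : ∀ G → Fin (length (history G)) → Point
point G i = proj₁ (entry G i)

lookup-history : ∀ G i → lookup (history G) i ≡ round (entry G i)
lookup-history (e ∷ G) zero    = refl
lookup-history (e ∷ G) (suc i) = lookup-history G i

entry-surjective : ∀ {e} G → e ∈ G → ∃[ i ] entry G i ≡ e
entry-surjective (e ∷ G) (here refl) = zero , refl
entry-surjective (_ ∷ G) (there e∈) with i , eq ← entry-surjective G e∈ = suc i , eq

⊲⇒Comparable : ∀ G {i j} → point G i ⊲ point G j → Presented (history G) i j
⊲⇒Comparable G {i} {j} lt rewrite lookup-history G i | lookup-history G j =
  fromℚ-<⁺ {position (point G i)} {position (point G j)} (⊲⇒+1< (point G i) (point G j) lt)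

Comparable⇒⊲ : ∀ G {i j} → Presented (history G) i j → point G i ⊲ point G j
Comparable⇒⊲ G {i} {j} lt rewrite lookup-history G i | lookup-history G j =
  +1<⇒⊲ (point G i) (point G j) (fromℚ-<⁻ {position (point G i)} {position (point G j)} lt)

Compatible : Point → Label → Entry → Set
Compatible p c (q , l) = c ≡ l → p ⊲ q ⊎ q ⊲ p

ChainPartition⇒Compatible : ∀ {p c} G → ChainPartition (history ((p , c) ∷ G)) → All (Compatible p c) G
ChainPartition⇒Compatible {p} {c} G cp = All.tabulate compatible
  where
  compatible : ∀ {e} → e ∈ G → Compatible p c e
  compatible e∈G c≡l with i , refl ← entry-surjective G e∈G =
    Sum.map (Comparable⇒⊲ ((p , c) ∷ G) {zero} {suc i}) (Comparable⇒⊲ ((p , c) ∷ G) {suc i} {zero})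
      (cp zero (suc i) (λ ()) (trans c≡l (sym (cong proj₂ (lookup-history G i)))))

-- Antichains and threshold cuts.

∣∣≤length-filter : ∀ {P : Pred Entry 0ℓ} (P? : Decidable P) G (S : Subset (length (history G))) →
                   (∀ {i} → i Subset.∈ S → P (entry G i)) → ∣ S ∣ ≤ length (filter P? G)
∣∣≤length-filter P? []      []            _   = z≤n
∣∣≤length-filter P? (e ∷ G) (inside ∷ S)  S⊆P with P? e
... | yes _ = s≤s (∣∣≤length-filter P? G S (S⊆P ∘ there))
... | no ¬p = contradiction (S⊆P here) ¬p
∣∣≤length-filter P? (e ∷ G) (outside ∷ S) S⊆P with P? e
... | yes _ = ℕ.m≤n⇒m≤1+n (∣∣≤length-filter P? G S (S⊆P ∘ there))
... | no  _ = ∣∣≤length-filter P? G S (S⊆P ∘ there)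

cluster : Entry → Cluster
cluster ((κ , _) , _) = κ

-- Each cut is itself an antichain: an outer and a middle point in it are separated by `τ` in the
-- order that makes their intervals meet.
LeftCut RightCut : ℚ → Pred Entry 0ℓ
LeftCut τ ((left   , s) , _) = τ ℚ.≤ value s
LeftCut τ ((middle , s) , _) = value s ℚ.≤ τ
LeftCut τ ((right  , s) , _) = ⊥
RightCut τ ((left   , s) , _) = ⊥
RightCut τ ((middle , s) , _) = τ ℚ.≤ value s
RightCut τ ((right  , s) , _) = value s ℚ.≤ τ

leftCut? : ∀ τ → Decidable (LeftCut τ)
leftCut? τ ((left   , s) , _) = τ ℚ.≤? value s
leftCut? τ ((middle , s) , _) = value s ℚ.≤? τ
leftCut? τ ((right  , s) , _) = no id

rightCut? : ∀ τ → Decidable (RightCut τ)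
rightCut? τ ((left   , s) , _) = no id
rightCut? τ ((middle , s) , _) = τ ℚ.≤? value s
rightCut? τ ((right  , s) , _) = value s ℚ.≤? τ

supremum : ∀ {n} {P : Pred (Fin n) 0ℓ} → Decidable P → (f : Fin n → Offset) →
  ∃[ τ ] ((∀ {i} → P i → value (f i) ℚ.≤ τ) × (∀ v → (∀ {i} → P i → f i ≼ v) → τ ℚ.≤ value v))
-- For the empty set 0 suffices, since minimality is only asked against bounds that are offsets, and
-- these are positive.
supremum {zero}  P? f = 0ℚ , (λ { {()} }) , λ v _ → ℚ.<⇒≤ (above-0 v)
supremum {suc n} P? f with P? zero | supremum (P? ∘ suc) (f ∘ suc)
... | no ¬p | τ , upper , least =
  τ , (λ { {zero} p → contradiction p ¬p ; {suc i} → upper }) , λ v ≤v → least v ≤v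
... | yes p | τ , upper , least =
  value (f zero) ℚ.⊔ τ ,
  (λ { {zero} _ → ℚ.p≤p⊔q (value (f zero)) τ
     ; {suc i} q → ℚ.≤-trans (upper q) (ℚ.p≤q⊔p (value (f zero)) τ) }) ,
  λ v ≤v → ℚ.⊔-lub (≤v p) (least v ≤v)

leftCut : ∀ {τ} e → (cluster e ≡ left → τ ℚ.≤ value (proj₂ (proj₁ e))) →
          (cluster e ≡ middle → value (proj₂ (proj₁ e)) ℚ.≤ τ) → cluster e ≢ right → LeftCut τ e
leftCut ((left   , _) , _) l m r = l refl
leftCut ((middle , _) , _) l m r = m refl
leftCut ((right  , _) , _) l m r = r refl

rightCut : ∀ {τ} e → cluster e ≢ left → (cluster e ≡ middle → τ ℚ.≤ value (proj₂ (proj₁ e))) →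
           (cluster e ≡ right → value (proj₂ (proj₁ e)) ℚ.≤ τ) → RightCut τ e
rightCut ((left   , _) , _) l m r = l refl
rightCut ((middle , _) , _) l m r = m refl
rightCut ((right  , _) , _) l m r = r refl

isMiddle? : ∀ e → Dec (cluster e ≡ middle)
isMiddle? ((left   , _) , _) = no λ ()
isMiddle? ((middle , _) , _) = yes refl
isMiddle? ((right  , _) , _) = no λ ()

isRight? : ∀ e → Dec (cluster e ≡ right)
isRight? ((left   , _) , _) = no λ ()
isRight? ((middle , _) , _) = no λ ()
isRight? ((right  , _) , _) = yes refl

-- An antichain cannot meet both outer clusters, and it is cut by the largest
-- offset occurring in the rightmost of the two clusters that it may meet.
width-bound : ∀ w G →
  (∀ τ → length (filter (leftCut? τ) G) ≤ w) → (∀ τ → length (filter (rightCut? τ) G) ≤ w) →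
  WidthAtMost (Presented (history G)) w
width-bound w G leftBound rightBound S anti =
  case any? (λ i → (i Subset.∈? S) ×-dec isRight? (entry G i)) of λ where
    (yes (j , j∈S , j-right)) → withRight j j∈S j-right
    (no  none)                → withoutRight λ i∈S i-right → none (_ , i∈S , i-right)
  where
  offset : Fin (length (history G)) → Offset
  offset i = proj₂ (point G i)

  incomparable : ∀ i j → i Subset.∈ S → j Subset.∈ S → ¬ point G i ⊲ point G j
  incomparable i j i∈S j∈S lt with i Fin.≟ j
  ... | yes refl = irrefl (point G i) lt
    where
    irrefl : ∀ p → ¬ p ⊲ p
    irrefl (left   , _) ()
    irrefl (middle , _) ()
    irrefl (right  , _) ()
  ... | no  i≢j  = anti i∈S j∈S i≢j (inj₁ (⊲⇒Comparable G {i} {j} lt))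

  ordered : ∀ i j → i Subset.∈ S → j Subset.∈ S →
            (∀ s t → s ≺ t → (cluster (entry G i) , s) ⊲ (cluster (entry G j) , t)) → offset j ≼ offset i
  ordered i j i∈S j∈S lift = ℚ.≮⇒≥ λ lt → incomparable i j i∈S j∈S (lift _ _ lt)

  left-middle : ∀ {κ κ′} → κ ≡ left → κ′ ≡ middle → ∀ s t → s ≺ t → (κ , s) ⊲ (κ′ , t)
  left-middle refl refl _ _ lt = lt

  middle-right : ∀ {κ κ′} → κ ≡ middle → κ′ ≡ right → ∀ s t → s ≺ t → (κ , s) ⊲ (κ′ , t)
  middle-right refl refl _ _ lt = lt

  left-right : ∀ p q → proj₁ p ≡ left → proj₁ q ≡ right → p ⊲ q
  left-right _ _ refl refl = tt

  withRight : ∀ j → j Subset.∈ S → cluster (entry G j) ≡ right → ∣ S ∣ ≤ w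
  withRight j j∈S j-right
    with τ , upper , least ← supremum (λ i → i Subset.∈? S ×-dec isRight? (entry G i)) offset =
    ℕ.≤-trans (∣∣≤length-filter (rightCut? τ) G S λ {i} i∈S → rightCut (entry G i)
        (λ i-left → incomparable i j i∈S j∈S (left-right (point G i) (point G j) i-left j-right))
        (λ i-middle → least (offset i) λ {l} (l∈S , l-right) →
          ordered i l i∈S l∈S (middle-right i-middle l-right))
        (λ i-right → upper (i∈S , i-right)))
      (rightBound τ)

  withoutRight : (∀ {i} → i Subset.∈ S → cluster (entry G i) ≢ right) → ∣ S ∣ ≤ w
  withoutRight none
    with τ , upper , least ← supremum (λ i → i Subset.∈? S ×-dec isMiddle? (entry G i)) offset =
    ℕ.≤-trans (∣∣≤length-filter (leftCut? τ) G S λ {i} i∈S → leftCut (entry G i)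
        (λ i-left → least (offset i) λ {l} (l∈S , l-middle) →
          ordered i l i∈S l∈S (left-middle i-left l-middle))
        (λ i-middle → upper (i∈S , i-middle))
        (none i∈S))
      (leftBound τ)

-- The game with one list of marks per cluster

Mark : Set
Mark = Offset × Label

tags : List Mark → List Label
tags = map proj₂

tagged : Cluster → Mark → Entry
tagged κ (s , c) = (κ , s) , c

config : (X D Y : List Mark) → List Entry
config X D Y = map (tagged left) X ++ map (tagged middle) D ++ map (tagged right) Y

from? : ∀ τ → Decidable {A = Mark} (λ e → τ ℚ.≤ value (proj₁ e))
from? τ e = τ ℚ.≤? value (proj₁ e)

upTo? : ∀ τ → Decidable {A = Mark} (λ e → value (proj₁ e) ℚ.≤ τ)
upTo? τ e = value (proj₁ e) ℚ.≤? τ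

above below : ℚ → List Mark → ℕ
above τ = length ∘ filter (from? τ)
below τ = length ∘ filter (upTo? τ)

length-filter-map : ∀ {A B : Set} {P : Pred B 0ℓ} (P? : Decidable P) (f : A → B) xs →
                    length (filter P? (map f xs)) ≡ length (filter (P? ∘ f) xs)
length-filter-map P? f []       = refl
length-filter-map P? f (x ∷ xs) with P? (f x)
... | yes _ = cong suc (length-filter-map P? f xs)
... | no  _ = length-filter-map P? f xs

length-filter-config : ∀ {P : Pred Entry 0ℓ} (P? : Decidable P) X D Y →
  length (filter P? (config X D Y)) ≡
  length (filter (P? ∘ tagged left) X) +
  (length (filter (P? ∘ tagged middle) D) + length (filter (P? ∘ tagged right) Y))
length-filter-config P? X D Y
  rewrite filter-++ P? (map (tagged left) X) (map (tagged middle) D ++ map (tagged right) Y)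
        | filter-++ P? (map (tagged middle) D) (map (tagged right) Y)
        | length-++ (filter P? (map (tagged left) X))
            {filter P? (map (tagged middle) D) ++ filter P? (map (tagged right) Y)}
        | length-++ (filter P? (map (tagged middle) D)) {filter P? (map (tagged right) Y)}
        | length-filter-map P? (tagged left) X
        | length-filter-map P? (tagged middle) D
        | length-filter-map P? (tagged right) Y = refl

module _ (w : ℕ) where

  -- The two cut bounds of `width-bound`, evaluated on `config X D Y` cluster by cluster.
  record Fits (X D Y : List Mark) : Set where
    constructor fits
    field
      leftLoad  : ∀ τ → above τ X + below τ D ≤ w
      rightLoad : ∀ τ → above τ D + below τ Y ≤ w

  open Fits

  Fits-length : ∀ {X Y} → length X ≤ w → length Y ≤ w → Fits X [] Y
  Fits-length {X} {Y} X≤w Y≤w = fits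
    (λ τ → ℕ.≤-trans (ℕ.≤-reflexive (ℕ.+-identityʳ _)) (ℕ.≤-trans (length-filter _ X) X≤w))
    (λ τ → ℕ.≤-trans (length-filter _ Y) Y≤w)

  Fits-respʳ : ∀ {X D Y Y′} → Y ↭ Y′ → Fits X D Y → Fits X D Y′
  Fits-respʳ {X} {D} p f = fits (leftLoad f) λ τ →
    subst (λ n → above τ D + n ≤ w) (↭-length (filter-↭ (upTo? τ) p)) (rightLoad f τ)

  Fits⇒WidthAtMost : ∀ {X D Y G} → G ↭ config X D Y → Fits X D Y → WidthAtMost (Presented (history G)) w
  Fits⇒WidthAtMost {X} {D} {Y} {G} p f = width-bound w G left≤ right≤
    where
    left≤ : ∀ τ → length (filter (leftCut? τ) G) ≤ w
    left≤ τ rewrite ↭-length (filter-↭ (leftCut? τ) p) | length-filter-config (leftCut? τ) X D Y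
                  | filter-none (leftCut? τ ∘ tagged right) {Y} (All.tabulate λ _ ())
                  | ℕ.+-identityʳ (below τ D) = leftLoad f τ

    right≤ : ∀ τ → length (filter (rightCut? τ) G) ≤ w
    right≤ τ rewrite ↭-length (filter-↭ (rightCut? τ) p) | length-filter-config (rightCut? τ) X D Y
                  | filter-none (rightCut? τ ∘ tagged left) {X} (All.tabulate λ _ ()) = rightLoad f τ

  module _ (K : ℕ) where

    -- The history is ordered by rounds and `config` by clusters. Cuts, labels and compatibility do
    -- not depend on the order, so positions of the game are taken up to permutation.
    Wins : (X D Y : List Mark) → Set₁
    Wins X D Y = Fits X D Y → ∀ {G} → G ↭ config X D Y → Winning w K (history G)

    Wins-respʳ : ∀ {X D Y Y′} → Y ↭ Y′ → Wins X D Y′ → Wins X D Y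
    Wins-respʳ {X} {D} p win f q = win (Fits-respʳ {X} {D} p f)
      (↭-trans q (↭-++⁺ˡ (map (tagged left) X) (↭-++⁺ˡ (map (tagged middle) D) (↭-map⁺ (tagged right) p))))

    finish : ∀ {X D Y L} → Unique L → K ≤ length L → L ⊆ tags X ++ tags D ++ tags Y → Wins X D Y
    finish {X} {D} {Y} {L} L! K≤ L⊆ f {G} p = stop (Fits⇒WidthAtMost p f) λ _ →
      ℕ.≤-trans K≤ (Unique⇒length≤chainsUsed (history G) L! (used ∘ L⊆))
      where
      tags-map : ∀ κ xs → map proj₂ (map (tagged κ) xs) ≡ tags xs
      tags-map κ xs = sym (map-∘ xs)
      labels-config : map proj₂ (config X D Y) ≡ tags X ++ tags D ++ tags Y
      labels-config
        rewrite map-++ proj₂ (map (tagged left) X) (map (tagged middle) D ++ map (tagged right) Y)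
              | map-++ proj₂ (map (tagged middle) D) (map (tagged right) Y)
              | tags-map left X | tags-map middle D | tags-map right Y = refl
      used : ∀ {l} → l ∈ tags X ++ tags D ++ tags Y → l ∈ labels (history G)
      used {l} l∈ = subst (l ∈_) (map-∘ G)
        (∈-resp-↭ (↭-map⁺ proj₂ (↭-sym p)) (subst (l ∈_) (sym labels-config) l∈))

    module _ (p : Point) (X′ D′ Y′ : Label → List Mark) where

      -- The three kinds of move differ only in the list that receives the new mark. Compatibility
      -- of the answer is decidable because the points are rational.
      play-point : ∀ {X D Y} → (∀ c → (p , c) ∷ config X D Y ↭ config (X′ c) (D′ c) (Y′ c)) →
                   (∀ c → Fits (X′ c) (D′ c) (Y′ c)) →
                   (∀ c → All (Compatible p c) (config X D Y) → Wins (X′ c) (D′ c) (Y′ c)) → Wins X D Y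
      play-point {X} {D} {Y} insert fits′ win _ {G} q = present (fromℚ (position p)) λ c →
        let q′ = ↭-trans (prep (p , c) q) (insert c) in
        case all? (compatible? c) G of λ where
          (yes compat) → win c (All-resp-↭ q compat) (fits′ c) q′
          -- A label that breaks the chain rule refutes `ChainPartition`, so the presenter may stop
          -- at once, owing only the width bound.
          (no ¬compat) → stop (Fits⇒WidthAtMost q′ (fits′ c)) λ cp →
            contradiction (ChainPartition⇒Compatible G cp) ¬compat
        where
        compatible? : ∀ c → Decidable (Compatible p c)
        compatible? c (q , l) = (c ℕ.≟ l) →-dec (p ⊲? q ⊎-dec q ⊲? p)

    private
      avoid : ∀ {κ s c xs G} → All (Compatible (κ , s) c) G →
              (∀ {e} → e ∈ xs → tagged κ e ∈ G) → c ∉ tags xs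
      avoid {κ} {s} {c} compat sub c∈ with (t , _) , e∈ , refl ← ∈-map⁻ proj₂ c∈ =
        [ same κ s t , same κ t s ]′ (All.lookup compat (sub e∈) refl)
        where
        same : ∀ κ s t → ¬ (κ , s) ⊲ (κ , t)
        same left   _ _ ()
        same middle _ _ ()
        same right  _ _ ()

    playLeft : ∀ {X D Y} s → (∀ c → Fits ((s , c) ∷ X) D Y) →
               (∀ c → c ∉ tags X → Wins ((s , c) ∷ X) D Y) → Wins X D Y
    playLeft {X} {D} {Y} s fits′ win = play-point (left , s) (λ c → (s , c) ∷ X) (λ _ → D) (λ _ → Y)
      (λ _ → ↭-refl) fits′ λ c compat → win c (avoid compat (∈-++⁺ˡ ∘ ∈-map⁺ _))

    playRight : ∀ {X D Y} s → (∀ c → Fits X D ((s , c) ∷ Y)) →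
                (∀ c → c ∉ tags Y → Wins X D ((s , c) ∷ Y)) → Wins X D Y
    playRight {X} {D} {Y} s fits′ win = play-point (right , s) (λ _ → X) (λ _ → D) (λ c → (s , c) ∷ Y)
      (λ c → ↭-sym (↭-trans (↭-++⁺ˡ (map (tagged left) X) (shift _ (map (tagged middle) D) _))
        (shift _ (map (tagged left) X) _)))
      fits′ λ c compat → win c
        (avoid compat (∈-++⁺ʳ (map (tagged left) X) ∘ ∈-++⁺ʳ (map (tagged middle) D) ∘ ∈-map⁺ _))

    playMiddle : ∀ {X D Y} s → (∀ c → Fits X ((s , c) ∷ D) Y) →
                 (∀ c → c ∉ tags D → (∀ {t l} → (t , l) ∈ X → s ≼ t → c ≢ l) →
                   (∀ {t l} → (t , l) ∈ Y → t ≼ s → c ≢ l) → Wins X ((s , c) ∷ D) Y) →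
                 Wins X D Y
    playMiddle {X} {D} {Y} s fits′ win = play-point (middle , s) (λ _ → X) (λ c → (s , c) ∷ D) (λ _ → Y)
      (λ c → ↭-sym (shift _ (map (tagged left) X) _))
      fits′ λ c compat → win c
        (avoid compat (∈-++⁺ʳ (map (tagged left) X) ∘ ∈-++⁺ˡ ∘ ∈-map⁺ _))
        (λ e∈X s≼t c≡l → [ id , (λ t≺s → ℚ-<⇒≱ t≺s s≼t) ]′
          (All.lookup compat (∈-++⁺ˡ (∈-map⁺ (tagged left) e∈X)) c≡l))
        (λ e∈Y t≼s c≡l → [ (λ s≺t → ℚ-<⇒≱ s≺t t≼s) , id ]′
          (All.lookup compat
            (∈-++⁺ʳ (map (tagged left) X) (∈-++⁺ʳ (map (tagged middle) D) (∈-map⁺ (tagged right) e∈Y))) c≡l))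

-- The strategy

AtMost AtLeast : Offset → List Mark → Set
AtMost  a = All (λ e → proj₁ e ≼ a)
AtLeast b = All (λ e → b ≼ proj₁ e)

-- `O` holds the points on which labels of `F` came back. Being distinct, they are at most as many
-- as `F`, which bounds both the width and the number of wasted rounds.
record Repeats (F O : List Mark) : Set where
  constructor repeats
  field
    repeated : tags O ⊆ tags F
    unique   : Unique (tags O)

  length≤ : length O ≤ length F
  length≤ = subst₂ _≤_ (length-map proj₂ O) (length-map proj₂ F) (Unique-⊆⇒length≤ unique repeated)

open Repeats

Repeats-[] : ∀ {F} → Repeats F []
Repeats-[] = repeats (λ ()) []

Repeats-∷ : ∀ {F O s c} → c ∈ tags F → c ∉ tags O → Repeats F O → Repeats F ((s , c) ∷ O)
Repeats-∷ c∈F c∉O r = repeats (λ { (here refl) → c∈F ; (there v) → repeated r v })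
                            (¬Any⇒All¬ _ c∉O ∷ unique r)

∉-tags-++ : ∀ {c} xs {ys} → c ∉ tags (xs ++ ys) → c ∉ tags xs × c ∉ tags ys
∉-tags-++ {c} xs {ys} c∉ rewrite map-++ proj₂ xs ys = c∉ ∘ ∈-++⁺ˡ , c∉ ∘ ∈-++⁺ʳ (tags xs)

∉-tags : ∀ {c xs} → (∀ {s l} → (s , l) ∈ xs → c ≢ l) → c ∉ tags xs
∉-tags c≢ c∈ with _ , e∈ , c≡ ← ∈-map⁻ proj₂ c∈ = c≢ e∈ c≡

∉-++ : ∀ {A : Set} {c : A} xs {ys} → c ∉ xs → c ∉ ys → c ∉ xs ++ ys
∉-++ xs c∉xs c∉ys = [ c∉xs , c∉ys ]′ ∘ ∈-++⁻ xs

Inside : Offset → Offset → List Mark → Set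
Inside a b = All (λ e → a ≺ proj₁ e × proj₁ e ≺ b)

-- Counting marks above and below a threshold.

module _ {A : Set} {P : Pred A 0ℓ} (P? : Decidable P) where

  length-filter-∷ : ∀ x xs → length (filter P? (x ∷ xs)) ≤ suc (length (filter P? xs))
  length-filter-∷ x xs with P? x
  ... | yes _ = ℕ.≤-refl
  ... | no  _ = ℕ.n≤1+n _

  length-filter-mono : ∀ {Q : Pred A 0ℓ} (Q? : Decidable Q) → (∀ {x} → P x → Q x) →
                       ∀ xs → length (filter P? xs) ≤ length (filter Q? xs)
  length-filter-mono Q? P⊆Q []       = z≤n
  length-filter-mono Q? P⊆Q (x ∷ xs) with P? x | Q? x
  ... | yes _ | yes _ = s≤s (length-filter-mono Q? P⊆Q xs)
  ... | yes p | no ¬q = contradiction (P⊆Q p) ¬q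
  ... | no  _ | yes _ = ℕ.m≤n⇒m≤1+n (length-filter-mono Q? P⊆Q xs)
  ... | no  _ | no  _ = length-filter-mono Q? P⊆Q xs

module _ (τ : ℚ) where

  above≤length : ∀ xs → above τ xs ≤ length xs
  above≤length = length-filter (from? τ)

  below≤length : ∀ xs → below τ xs ≤ length xs
  below≤length = length-filter (upTo? τ)

  above-++ : ∀ xs ys → above τ (xs ++ ys) ≡ above τ xs + above τ ys
  above-++ xs ys = trans (cong length (filter-++ (from? τ) xs ys)) (length-++ (filter (from? τ) xs))

  below-++ : ∀ xs ys → below τ (xs ++ ys) ≡ below τ xs + below τ ys
  below-++ xs ys = trans (cong length (filter-++ (upTo? τ) xs ys)) (length-++ (filter (upTo? τ) xs))

  above-reject : ∀ {e xs} → value (proj₁ e) ℚ.< τ → above τ (e ∷ xs) ≡ above τ xs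
  above-reject e<τ = cong length (filter-reject (from? τ) (ℚ-<⇒≱ e<τ))

  below-reject : ∀ {e xs} → τ ℚ.< value (proj₁ e) → below τ (e ∷ xs) ≡ below τ xs
  below-reject τ<e = cong length (filter-reject (upTo? τ) (ℚ-<⇒≱ τ<e))

  above-none : ∀ {xs} → All (λ e → value (proj₁ e) ℚ.< τ) xs → above τ xs ≡ 0
  above-none xs<τ = cong length (filter-none (from? τ) (All.map ℚ-<⇒≱ xs<τ))

  below-none : ∀ {xs} → All (λ e → τ ℚ.< value (proj₁ e)) xs → below τ xs ≡ 0
  below-none τ<xs = cong length (filter-none (upTo? τ) (All.map ℚ-<⇒≱ τ<xs))

  above-∷ : ∀ e xs → above τ (e ∷ xs) ≤ suc (above τ xs)
  above-∷ = length-filter-∷ (from? τ)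

  below-∷ : ∀ e xs → below τ (e ∷ xs) ≤ suc (below τ xs)
  below-∷ = length-filter-∷ (upTo? τ)

above-antitone : ∀ {σ τ} xs → σ ℚ.≤ τ → above τ xs ≤ above σ xs
above-antitone xs σ≤τ = length-filter-mono (from? _) (from? _) (ℚ.≤-trans σ≤τ) xs

below-monotone : ∀ {σ τ} xs → σ ℚ.≤ τ → below σ xs ≤ below τ xs
below-monotone xs σ≤τ = length-filter-mono (upTo? _) (upTo? _) (λ e≤σ → ℚ.≤-trans e≤σ σ≤τ) xs

-- The offset `b` separates `D` from `O`, so no threshold sees both: below `b` the marks of `O` do
-- not count, and from `b` on those of `D` do not.
rightLoad-++ : ∀ {w b D O} V → All (λ e → proj₁ e ≺ b) D → AtLeast b O → length (V ++ O) ≤ w →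
  (∀ τ → above τ D + below τ V ≤ w) → ∀ τ → above τ D + below τ (V ++ O) ≤ w
rightLoad-++ {w} {b} {D} {O} V D≺b b≼O V+O≤w load τ with τ ℚ.<? value b
... | yes τ<b rewrite below-++ τ V O | below-none τ (All.map (ℚ.<-≤-trans τ<b) b≼O)
                    | ℕ.+-identityʳ (below τ V) = load τ
... | no  τ≮b rewrite above-none τ (All.map (λ e≺b → ℚ.<-≤-trans e≺b (ℚ.≮⇒≥ τ≮b)) D≺b) =
  ℕ.≤-trans (below≤length τ (V ++ O)) V+O≤w

-- The opening, common to both parities.

module Strategy (w K : ℕ) where

  module Opening (k : ℕ) (k+k≤w : k + k ≤ w) where

    -- Repeated labels push the gap (a, b) from the right, so that the first
    -- new label lies to the left of all of them.
    extendRight : ∀ m {X C N O} a b → length X ≤ w → m + length O ≡ length C → length N + length C < w →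
      a ≺ b → AtLeast b O → Repeats C O →
      (∀ {y c O′} b′ → a ≺ y → y ≺ b′ → b′ ≼ b → AtLeast b′ O′ → Repeats C O′ →
        c ∉ tags C → c ∉ tags N → Wins w K X [] (((y , c) ∷ N) ++ O′)) →
      Wins w K X [] (N ++ O)
    extendRight m {X} {C} {N} {O} a b X≤w m+O≡C N+C<w a≺b b≼O rep win
      with y , a≺y , y≺b ← ≺-dense {a} {b} a≺b =
      playRight w K y (λ c → Fits-length w X≤w room) answer
      where
      room : suc (length (N ++ O)) ≤ w
      room rewrite length-++ N {O} = ℕ.≤-trans (s≤s (ℕ.+-monoʳ-≤ (length N) (length≤ rep))) N+C<w

      answer : ∀ c → c ∉ tags (N ++ O) → Wins w K X [] ((y , c) ∷ N ++ O)
      answer c c∉ with c∉N , c∉O ← ∉-tags-++ N c∉ with c ∈? tags C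
      ... | no  c∉C = win b a≺y y≺b ℚ.≤-refl b≼O rep c∉C c∉N
      ... | yes c∈C = Wins-respʳ w K (↭-sym (shift (y , c) N O)) (continue m m+O≡C)
        where
        rep′ : Repeats C ((y , c) ∷ O)
        rep′ = Repeats-∷ c∈C c∉O rep
        continue : ∀ m → m + length O ≡ length C → Wins w K X [] (N ++ (y , c) ∷ O)
        -- At `m = 0` the list `O` is as long as `C`, so one more repetition would contradict
        -- `length≤`.
        continue zero    O≡C = contradiction (length≤ rep′) (ℕ.<⇒≱ (s≤s (ℕ.≤-reflexive (sym O≡C))))
        continue (suc m) eq  = extendRight m a y X≤w (trans (ℕ.+-suc m (length O)) eq) N+C<w a≺y
          (ℚ.≤-refl ∷ All.map (ℚ.≤-trans (ℚ.<⇒≤ y≺b)) b≼O) rep′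
          λ b′ a≺z z≺b′ b′≼y → win b′ a≺z z≺b′ (ℚ.≤-trans b′≼y (ℚ.<⇒≤ y≺b))

    -- The mirror image of `extendRight`: left points whose labels repeat `N` push `a`, so the first
    -- label outside `N` appears to the right of all of `B`.
    extendLeft : ∀ m {B C N Y} a b → length Y ≤ w → m + length B ≡ length N → length N + length C < w →
      a ≺ b → AtMost a B → Repeats N B →
      (∀ {z c B′} a′ → a′ ≺ z → z ≺ b → a ≼ a′ → AtMost a′ B′ → Repeats N B′ →
        c ∉ tags C → c ∉ tags N → Wins w K (((z , c) ∷ B′) ++ C) [] Y) →
      Wins w K (B ++ C) [] Y
    extendLeft m {B} {C} {N} {Y} a b Y≤w m+B≡N N+C<w a≺b B≼a rep win
      with z , a≺z , z≺b ← ≺-dense {a} {b} a≺b =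
      playLeft w K z (λ c → Fits-length w room Y≤w) answer
      where
      room : suc (length (B ++ C)) ≤ w
      room rewrite length-++ B {C} = ℕ.≤-trans (s≤s (ℕ.+-monoˡ-≤ (length C) (length≤ rep))) N+C<w

      answer : ∀ c → c ∉ tags (B ++ C) → Wins w K ((z , c) ∷ B ++ C) [] Y
      answer c c∉ with c∉B , c∉C ← ∉-tags-++ B c∉ with c ∈? tags N
      ... | no  c∉N = win a a≺z z≺b ℚ.≤-refl B≼a rep c∉C c∉N
      ... | yes c∈N = continue m m+B≡N
        where
        rep′ : Repeats N ((z , c) ∷ B)
        rep′ = Repeats-∷ c∈N c∉B rep
        continue : ∀ m → m + length B ≡ length N → Wins w K ((z , c) ∷ B ++ C) [] Y
        continue zero    B≡N = contradiction (length≤ rep′) (ℕ.<⇒≱ (s≤s (ℕ.≤-reflexive (sym B≡N))))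
        continue (suc m) eq  = extendLeft m z b Y≤w (trans (ℕ.+-suc m (length B)) eq) N+C<w z≺b
          (ℚ.≤-refl ∷ All.map (λ e≼a → ℚ.≤-trans e≼a (ℚ.<⇒≤ a≺z)) B≼a) rep′
          λ a′ a′≺y y≺b z≼a′ → win a′ a′≺y y≺b (ℚ.≤-trans (ℚ.<⇒≤ a≺z) z≼a′)

    fresh-∷ : ∀ {c} N {C} → c ∉ tags C → c ∉ tags N →
              Unique (tags N ++ tags C) → Unique (c ∷ tags N ++ tags C)
    fresh-∷ N c∉C c∉N u = ¬Any⇒All¬ _ (∉-++ (tags N) c∉N c∉C) ∷ u

    -- A middle point strictly inside the gap meets all of `C` and `N` and none of `O`.
    record Opened (C N O : List Mark) (a b : Offset) : Set where
      field
        |C|≡k : length C ≡ k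
        |N|≡k : length N ≡ k
        gap   : a ≺ b
        C≽b   : AtLeast b C
        N≼a   : AtMost a N
        O≽b   : AtLeast b O
        reps  : Repeats C O
        new   : Unique (tags N ++ tags C)

    -- Here `n` counts the labels still missing from `N`. Each new one is found inside the gap, and
    -- its offset becomes the left end, which keeps `N` to the left.
    collect : ∀ n {C N O} a b → n + length N ≡ k → length C ≡ k → a ≺ b →
      AtLeast b C → AtMost a N → AtLeast b O →
      Repeats C O → Unique (tags N ++ tags C) →
      (∀ {N O} a b → Opened C N O a b → Wins w K C [] (N ++ O)) →
      Wins w K C [] (N ++ O)
    collect zero    a b eq C≡k a≺b C≽b N≼a O≽b reps u win = win a b record
      { |C|≡k = C≡k ; |N|≡k = eq ; gap = a≺b ; C≽b = C≽b ; N≼a = N≼a ; O≽b = O≽b ; reps = reps ; new = u }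
    collect (suc n) {C} {N} {O} a b eq C≡k a≺b C≽b N≼a O≽b reps u win =
      -- The first argument counts the labels of `C` not yet repeated in `O`.
      extendRight (length C ∸ length O) a b
        (ℕ.≤-trans (ℕ.≤-reflexive C≡k) (ℕ.≤-trans (ℕ.m≤m+n k k) k+k≤w))
        (ℕ.m∸n+n≡m (length≤ reps))
        (ℕ.≤-trans
          (ℕ.+-mono-≤ (ℕ.≤-trans (s≤s (ℕ.m≤n+m (length N) n)) (ℕ.≤-reflexive eq)) (ℕ.≤-reflexive C≡k))
          k+k≤w)
        a≺b O≽b reps
        λ {y} b′ a≺y y≺b′ b′≼b O′≽b′ reps′ c∉C c∉N →
          collect n y b′ (trans (ℕ.+-suc n (length N)) eq) C≡k y≺b′
            (All.map (ℚ.≤-trans b′≼b) C≽b)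
            (ℚ.≤-refl ∷ All.map (λ e≼a → ℚ.≤-trans e≼a (ℚ.<⇒≤ a≺y)) N≼a)
            O′≽b′ reps′ (fresh-∷ N c∉C c∉N u) win

    stack : ∀ n {C} b → n + length C ≡ k → AtLeast b C → Unique (tags C) →
      (∀ {C} → length C ≡ k → AtLeast b C → Unique (tags C) → Wins w K C [] []) → Wins w K C [] []
    stack zero    b eq C≽b u win = win eq C≽b u
    stack (suc n) {C} b eq C≽b u win =
      playLeft w K b (λ c → Fits-length w
        (ℕ.≤-trans (ℕ.≤-trans (s≤s (ℕ.m≤n+m (length C) n)) (ℕ.≤-reflexive eq)) (ℕ.≤-trans (ℕ.m≤m+n k k) k+k≤w)) z≤n)
      λ c c∉C → stack n b (trans (ℕ.+-suc n (length C)) eq) (ℚ.≤-refl ∷ C≽b) (¬Any⇒All¬ _ c∉C ∷ u) win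

    opening : ∀ a b → a ≺ b → (∀ {C N O} a b → Opened C N O a b → Wins w K C [] (N ++ O)) → Wins w K [] [] []
    opening a b a≺b win = stack k b (ℕ.+-identityʳ k) [] [] λ C≡k C≽b u →
      collect k a b (ℕ.+-identityʳ k) C≡k a≺b C≽b [] [] Repeats-[] u win

    -- One offset `m` in the gap serves all k middle points. A cut holds at most k of them together
    -- with at most k marks of `C` or of `N`, or else no middle point at all.
    evenEnding : w ≡ k + k → K ≡ k + (k + k) → ∀ {C N O} a b → Opened C N O a b → Wins w K C [] (N ++ O)
    evenEnding refl refl {C} {N} {O} a b st with m , a≺m , m≺b ← ≺-dense {a} {b} (Opened.gap st) =
      stackMiddle k (ℕ.+-identityʳ k) [] (Opened.new st)
      where
      open Opened st
      Y≤w : length (N ++ O) ≤ k + k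
      Y≤w rewrite length-++ N {O} =
        ℕ.+-mono-≤ (ℕ.≤-reflexive |N|≡k) (ℕ.≤-trans (length≤ reps) (ℕ.≤-reflexive |C|≡k))

      fits-middle : ∀ {D} → Inside a b D → length D ≤ k → Fits (k + k) C D (N ++ O)
      fits-middle {D} D⊂ D≤k = fits
        (λ τ → ℕ.+-mono-≤ (ℕ.≤-trans (above≤length τ C) (ℕ.≤-reflexive |C|≡k))
               (ℕ.≤-trans (below≤length τ D) D≤k))
        (rightLoad-++ {b = b} N (All.map proj₂ D⊂) O≽b Y≤w
          λ τ → ℕ.+-mono-≤ (ℕ.≤-trans (above≤length τ D) D≤k)
                  (ℕ.≤-trans (below≤length τ N) (ℕ.≤-reflexive |N|≡k)))

      stackMiddle : ∀ n {D} → n + length D ≡ k → Inside a b D → Unique (tags D ++ tags N ++ tags C) →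
        Wins (k + k) K C D (N ++ O)
      stackMiddle zero {D} D≡k D⊂ u =
        finish w _ {X = C} {D = D} u (ℕ.≤-reflexive (sym size)) sub
        where
        size : length (tags D ++ tags N ++ tags C) ≡ k + (k + k)
        size rewrite length-++ (tags D) {tags N ++ tags C} | length-++ (tags N) {tags C}
                   | length-map proj₂ D | length-map proj₂ N | length-map proj₂ C
                   | D≡k | |N|≡k | |C|≡k = refl
        sub : tags D ++ tags N ++ tags C ⊆ tags C ++ tags D ++ tags (N ++ O)
        sub l∈ with ∈-++⁻ (tags D) l∈
        ... | inj₁ l∈D = ∈-++⁺ʳ (tags C) (∈-++⁺ˡ l∈D)
        ... | inj₂ l∈′ with ∈-++⁻ (tags N) l∈′
        ... | inj₁ l∈N rewrite map-++ proj₂ N O = ∈-++⁺ʳ (tags C) (∈-++⁺ʳ (tags D) (∈-++⁺ˡ l∈N))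
        ... | inj₂ l∈C = ∈-++⁺ˡ l∈C
      stackMiddle (suc n) {D} eq D⊂ u =
        playMiddle w _ m
          (λ c → fits-middle ((a≺m , m≺b) ∷ D⊂) (ℕ.≤-trans (s≤s (ℕ.m≤n+m (length D) n)) (ℕ.≤-reflexive eq)))
          λ c c∉D c∉X c∉Y → stackMiddle n (trans (ℕ.+-suc n (length D)) eq) ((a≺m , m≺b) ∷ D⊂)
            (¬Any⇒All¬ _ (∉-++ (tags D) c∉D (∉-++ (tags N)
              (∉-tags λ e∈N → c∉Y (∈-++⁺ˡ e∈N) (ℚ.≤-trans (All.lookup N≼a e∈N) (ℚ.<⇒≤ a≺m)))
              (∉-tags λ e∈C → c∉X e∈C (ℚ.≤-trans (ℚ.<⇒≤ m≺b) (All.lookup C≽b e∈C))))) ∷ u)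

    -- The last phase for odd width.

    module Endgame
      (w≡ : w ≡ suc (k + k)) (K≡ : K ≡ suc (suc k + (k + k))) (1≤k : 1 ≤ k)
      {B C N O : List Mark} {a b z y : Offset} {lz ly : Label}
      (|B|≤k : length B ≤ k) (|C|≡k : length C ≡ k) (|N|≡k : length N ≡ k) (|O|≤k : length O ≤ k)
      (a≺z : a ≺ z) (z≺y : z ≺ y) (y≺b : y ≺ b)
      (B≼a : AtMost a B) (b≼C : AtLeast b C) (N≼a : AtMost a N) (b≼O : AtLeast b O)
      (N++C! : Unique (tags N ++ tags C))
      (lz∉C : lz ∉ tags C) (lz∉N : lz ∉ tags N) (ly∉C : ly ∉ tags C) (ly∉N : ly ∉ tags N)
      where

      -- From left to right, the offsets are those of `B` and `N` up to `a`, then `z`, then `y`,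
      -- then from `b` on those of `C` and `O`.
      X₀ Y₀ : List Mark
      X₀ = (z , lz) ∷ B ++ C
      Y₀ = ((y , ly) ∷ N) ++ O

      a≺y : a ≺ y
      a≺y = ℚ.<-trans a≺z z≺y

      z≺b : z ≺ b
      z≺b = ℚ.<-trans z≺y y≺b

      -- A cut through `z` already holds `z` and k marks of `C`, leaving room for k middle points; a
      -- cut through `y` likewise holds `y` and `N`. Away from both, k + 1 middle points fit.
      record Fitting (D : List Mark) : Set where
        constructor fitting
        field
          D⊂    : Inside a b D
          small : length D ≤ suc k
          seesZ : below (value z) D ≤ k
          seesY : above (value y) D ≤ k

      -- For the left cuts there are three ranges of `τ`: beyond `z` only `C` and `D` count; between
      -- `a` and `z` the mark `z` joins, but `seesZ` limits `D`; up to `a` no mark of `D` counts.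
      -- The right cuts split at `y`, with `O` handled by `rightLoad-++`.
      Fitting⇒Fits : ∀ {D} → Fitting D → Fits w X₀ D Y₀
      Fitting⇒Fits {D} (fitting D⊂ small seesZ seesY) rewrite w≡ = fits left≤
        (rightLoad-++ {b = b} ((y , ly) ∷ N) (All.map proj₂ D⊂) b≼O Y₀≤ right≤)
        where
        Y₀≤ : length Y₀ ≤ suc (k + k)
        Y₀≤ rewrite length-++ N {O} | |N|≡k = s≤s (ℕ.+-monoʳ-≤ k |O|≤k)
        X₀≤ : length X₀ ≤ suc (k + k)
        X₀≤ rewrite length-++ B {C} | |C|≡k = s≤s (ℕ.+-monoˡ-≤ k |B|≤k)

        right≤ : ∀ τ → above τ D + below τ ((y , ly) ∷ N) ≤ suc (k + k)
        right≤ τ with value y ℚ.≤? τ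
        ... | yes y≤τ = ℕ.≤-trans
          (ℕ.+-mono-≤ (ℕ.≤-trans (above-antitone D y≤τ) seesY)
            (ℕ.≤-trans (below≤length τ ((y , ly) ∷ N)) (s≤s (ℕ.≤-reflexive |N|≡k))))
          (ℕ.≤-reflexive (ℕ.+-suc k k))
        ... | no  y≰τ rewrite below-reject τ {y , ly} {N} (ℚ.≰⇒> y≰τ) =
          ℕ.+-mono-≤ (ℕ.≤-trans (above≤length τ D) small)
            (ℕ.≤-trans (below≤length τ N) (ℕ.≤-reflexive |N|≡k))

        above-B++C : ∀ τ → value a ℚ.< τ → above τ (B ++ C) ≤ k
        above-B++C τ a<τ rewrite above-++ τ B C | above-none τ (All.map (λ e≼a → ℚ.≤-<-trans e≼a a<τ) B≼a) =
          ℕ.≤-trans (above≤length τ C) (ℕ.≤-reflexive |C|≡k)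

        left≤ : ∀ τ → above τ X₀ + below τ D ≤ suc (k + k)
        left≤ τ with τ ℚ.≤? value z | value a ℚ.<? τ
        ... | no  τ≰z | _ rewrite above-reject τ {z , lz} {B ++ C} (ℚ.≰⇒> τ≰z) = ℕ.≤-trans
          (ℕ.+-mono-≤ (above-B++C τ (ℚ.<-trans a≺z (ℚ.≰⇒> τ≰z))) (ℕ.≤-trans (below≤length τ D) small))
          (ℕ.≤-reflexive (ℕ.+-suc k k))
        ... | yes τ≤z | yes a<τ =
          ℕ.+-mono-≤ (ℕ.≤-trans (above-∷ τ (z , lz) (B ++ C)) (s≤s (above-B++C τ a<τ)))
            (ℕ.≤-trans (below-monotone D τ≤z) seesZ)
        ... | yes _   | no  a≮τ rewrite below-none τ (All.map (λ e → ℚ.≤-<-trans (ℚ.≮⇒≥ a≮τ) (proj₁ e)) D⊂)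
                                      | ℕ.+-identityʳ (above τ X₀) = ℕ.≤-trans (above≤length τ X₀) X₀≤

      Distinct : List Mark → Set
      Distinct D = Unique (tags D ++ tags N ++ tags C)

      playInside : ∀ {D} p → a ≺ p → p ≺ b → (∀ c → Fitting ((p , c) ∷ D)) → Distinct D →
        (∀ c → Distinct ((p , c) ∷ D) → (p ≼ z → c ≢ lz) → (y ≼ p → c ≢ ly) →
          Wins w K X₀ ((p , c) ∷ D) Y₀) →
        Wins w K X₀ D Y₀
      playInside {D} p a≺p p≺b fit D! win = playMiddle w K p (Fitting⇒Fits ∘ fit) λ c c∉D c∉X c∉Y →
        win c
          (¬Any⇒All¬ _ (∉-++ (tags D) c∉D (∉-++ (tags N)
            (∉-tags λ e∈N → c∉Y (there (∈-++⁺ˡ e∈N)) (ℚ.≤-trans (All.lookup N≼a e∈N) (ℚ.<⇒≤ a≺p)))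
            (∉-tags λ e∈C → c∉X (there (∈-++⁺ʳ B e∈C)) (ℚ.≤-trans (ℚ.<⇒≤ p≺b) (All.lookup b≼C e∈C))))) ∷ D!)
          (c∉X (here refl)) (c∉Y (here refl))

      -- The k + 1 middle labels and the 2k labels of `N` and `C` fall one short of `K`; the label
      -- `l` of `z` or `y` supplies the last.
      finishInside : ∀ {D l} → length D ≡ suc k → Distinct D → l ∉ tags D → l ∉ tags C → l ∉ tags N →
        l ∈ tags X₀ ++ tags D ++ tags Y₀ → Wins w K X₀ D Y₀
      finishInside {D} {l} D≡ D! l∉D l∉C l∉N l∈ =
        finish w K {X₀} {D} {Y₀} (¬Any⇒All¬ _ (∉-++ (tags D) l∉D (∉-++ (tags N) l∉N l∉C)) ∷ D!)
          (ℕ.≤-reflexive (trans K≡ (cong suc (sym size)))) λ where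
            (here refl) → l∈
            (there l∈)  → sub l∈
        where
        size : length (tags D ++ tags N ++ tags C) ≡ suc k + (k + k)
        size rewrite length-++ (tags D) {tags N ++ tags C} | length-++ (tags N) {tags C}
                   | length-map proj₂ D | length-map proj₂ N | length-map proj₂ C
                   | D≡ | |N|≡k | |C|≡k = refl
        sub : tags D ++ tags N ++ tags C ⊆ tags X₀ ++ tags D ++ tags Y₀
        sub l∈ with ∈-++⁻ (tags D) l∈
        ... | inj₁ l∈D = ∈-++⁺ʳ (tags X₀) (∈-++⁺ˡ l∈D)
        ... | inj₂ l∈′ with ∈-++⁻ (tags N) l∈′
        ... | inj₁ l∈N rewrite map-++ proj₂ N O = ∈-++⁺ʳ (tags X₀) (∈-++⁺ʳ (tags D) (there (∈-++⁺ˡ l∈N)))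
        ... | inj₂ l∈C rewrite map-++ proj₂ B C = ∈-++⁺ˡ (there (∈-++⁺ʳ (tags B) l∈C))

      -- Saves `ly` as the extra label: points at `y` meet the mark there and must avoid `ly`, while
      -- they miss `z` and leave its load unchanged. The bound on `n + above (value y) D` reserves
      -- room for the n points to come.
      fillY : ∀ n {D} → n + length D ≡ suc k → Inside a b D →
        below (value z) D ≤ k → n + above (value y) D ≤ k →
        Distinct D → ly ∉ tags D → Wins w K X₀ D Y₀
      fillY zero    {D} eq D⊂ seesZ seesY D! ly∉D =
        finishInside {l = ly} eq D! ly∉D ly∉C ly∉N (∈-++⁺ʳ (tags X₀) (∈-++⁺ʳ (tags D) (here refl)))
      fillY (suc n) {D} eq D⊂ seesZ seesY D! ly∉D =
        playInside y a≺y y≺b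
          (λ c → fitting D⊂′ (ℕ.≤-trans (ℕ.m≤n+m _ n) (ℕ.≤-reflexive eq′)) (seesZ′ c)
            (ℕ.≤-trans (ℕ.m≤n+m _ n) (seesY′ c)))
          D! λ c c! _ c≢ly → fillY n eq′ D⊂′ (seesZ′ c) (seesY′ c) c!
            λ { (here ly≡c) → c≢ly ℚ.≤-refl (sym ly≡c) ; (there ly∈D) → ly∉D ly∈D }
        where
        eq′ : n + suc (length D) ≡ suc k
        eq′ = trans (ℕ.+-suc n (length D)) eq
        D⊂′ : ∀ {c} → Inside a b ((y , c) ∷ D)
        D⊂′ = (a≺y , y≺b) ∷ D⊂
        seesZ′ : ∀ c → below (value z) ((y , c) ∷ D) ≤ k
        seesZ′ c rewrite below-reject (value z) {y , c} {D} z≺y = seesZ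
        seesY′ : ∀ c → n + above (value y) ((y , c) ∷ D) ≤ k
        seesY′ c = ℕ.≤-trans (ℕ.+-monoʳ-≤ n (above-∷ (value y) (y , c) D))
          (ℕ.≤-trans (ℕ.≤-reflexive (ℕ.+-suc n _)) seesY)

      -- The mirror image of `fillY`, saving `lz`.
      fillZ : ∀ n {D} → n + length D ≡ suc k → Inside a b D →
        n + below (value z) D ≤ k → above (value y) D ≤ k →
        Distinct D → lz ∉ tags D → Wins w K X₀ D Y₀
      fillZ zero    {D} eq D⊂ seesZ seesY D! lz∉D =
        finishInside {l = lz} eq D! lz∉D lz∉C lz∉N (here refl)
      fillZ (suc n) {D} eq D⊂ seesZ seesY D! lz∉D =
        playInside z a≺z z≺b
          (λ c → fitting D⊂′ (ℕ.≤-trans (ℕ.m≤n+m _ n) (ℕ.≤-reflexive eq′))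
            (ℕ.≤-trans (ℕ.m≤n+m _ n) (seesZ′ c)) (seesY′ c))
          D! λ c c! c≢lz _ → fillZ n eq′ D⊂′ (seesZ′ c) (seesY′ c) c!
            λ { (here lz≡c) → c≢lz ℚ.≤-refl (sym lz≡c) ; (there lz∈D) → lz∉D lz∈D }
        where
        eq′ : n + suc (length D) ≡ suc k
        eq′ = trans (ℕ.+-suc n (length D)) eq
        D⊂′ : ∀ {c} → Inside a b ((z , c) ∷ D)
        D⊂′ = (a≺z , z≺b) ∷ D⊂
        seesY′ : ∀ c → above (value y) ((z , c) ∷ D) ≤ k
        seesY′ c rewrite above-reject (value y) {z , c} {D} z≺y = seesY
        seesZ′ : ∀ c → n + below (value z) ((z , c) ∷ D) ≤ k
        seesZ′ c = ℕ.≤-trans (ℕ.+-monoʳ-≤ n (below-∷ (value z) (z , c) D))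
          (ℕ.≤-trans (ℕ.≤-reflexive (ℕ.+-suc n _)) seesZ)

      -- The common label is avoided both at `z` and at `y`, so it can be saved at either place. All
      -- points but one go to `z`, hence the `suc n` in the count.
      fillEqual : lz ≡ ly → ∀ n {D} → suc n + length D ≡ suc k → Inside a b D → above (value y) D ≡ 0 →
        Distinct D → ly ∉ tags D → Wins w K X₀ D Y₀
      fillEqual lz≡ly zero    {D} eq D⊂ seesY D! ly∉D =
        -- `D` has reached length k, all that `z` may meet, so the last point goes to `y`, where
        -- `1≤k` leaves room.
        fillY 1 eq D⊂ (ℕ.≤-trans (below≤length (value z) D) (ℕ.≤-reflexive (ℕ.suc-injective eq)))
          (subst (λ n → suc n ≤ k) (sym seesY) 1≤k) D! ly∉D
      fillEqual lz≡ly (suc n) {D} eq D⊂ seesY D! ly∉D =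
        playInside z a≺z z≺b
          (λ c → fitting D⊂′ (ℕ.m≤n⇒m≤1+n size≤) (ℕ.≤-trans (below≤length (value z) ((z , c) ∷ D)) size≤)
            (ℕ.≤-trans (ℕ.≤-reflexive (seesY′ c)) z≤n))
          D! λ c c! c≢lz _ → fillEqual lz≡ly n eq′ D⊂′ (seesY′ c) c!
            λ { (here ly≡c) → c≢lz ℚ.≤-refl (trans (sym ly≡c) (sym lz≡ly)) ; (there ly∈D) → ly∉D ly∈D }
        where
        eq′ : suc n + suc (length D) ≡ suc k
        eq′ = trans (cong suc (ℕ.+-suc n (length D))) eq
        size≤ : suc (length D) ≤ k
        size≤ = ℕ.≤-trans (ℕ.m≤n+m _ n) (ℕ.≤-reflexive (ℕ.suc-injective eq′))
        D⊂′ : ∀ {c} → Inside a b ((z , c) ∷ D)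
        D⊂′ = (a≺z , z≺b) ∷ D⊂
        seesY′ : ∀ c → above (value y) ((z , c) ∷ D) ≡ 0
        seesY′ c = trans (above-reject (value y) {z , c} {D} z≺y) seesY

      module _ (lz≢ly : lz ≢ ly) (m : Offset) (z≺m : z ≺ m) (m≺y : m ≺ y) where

        fillBetween : ∀ n {D} → n + length D ≡ suc k → Inside a b D →
          below (value z) D ≡ 0 → above (value y) D ≡ 0 →
          Distinct D → lz ∉ tags D → ly ∉ tags D → Wins w K X₀ D Y₀
        fillBetween zero    eq D⊂ seesZ seesY D! lz∉D ly∉D =
          -- No point remains to be played and both labels are still free; `lz` is taken as the
          -- extra one.
          fillZ zero eq D⊂ (ℕ.≤-trans (ℕ.≤-reflexive seesZ) z≤n) (ℕ.≤-trans (ℕ.≤-reflexive seesY) z≤n) D! lz∉D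
        fillBetween (suc n) {D} eq D⊂ seesZ seesY D! lz∉D ly∉D =
          playInside m a≺m m≺b
            (λ c → fitting D⊂′ (ℕ.≤-trans (ℕ.m≤n+m _ n) (ℕ.≤-reflexive eq′))
              (≡0⇒≤ (seesZ′ c)) (≡0⇒≤ (seesY′ c)))
            D! answer
          where
          a≺m : a ≺ m
          a≺m = ℚ.<-trans a≺z z≺m
          m≺b : m ≺ b
          m≺b = ℚ.<-trans m≺y y≺b
          ≡0⇒≤ : ∀ {i j} → i ≡ 0 → i ≤ j
          ≡0⇒≤ refl = z≤n
          eq′ : n + suc (length D) ≡ suc k
          eq′ = trans (ℕ.+-suc n (length D)) eq
          -- The point at `m` uses up one of the k + 1, so all the others have room at `y`, or all
          -- at `z`.
          n≤k : n ≤ k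
          n≤k = ℕ.≤-trans (ℕ.m≤m+n n (length D)) (ℕ.≤-reflexive (ℕ.suc-injective eq))
          D⊂′ : ∀ {c} → Inside a b ((m , c) ∷ D)
          D⊂′ = (a≺m , m≺b) ∷ D⊂
          seesZ′ : ∀ c → below (value z) ((m , c) ∷ D) ≡ 0
          seesZ′ c = trans (below-reject (value z) {m , c} {D} z≺m) seesZ
          seesY′ : ∀ c → above (value y) ((m , c) ∷ D) ≡ 0
          seesY′ c = trans (above-reject (value y) {m , c} {D} m≺y) seesY
          n+0≤k : ∀ {i} → i ≡ 0 → n + i ≤ k
          n+0≤k refl = ℕ.≤-trans (ℕ.≤-reflexive (ℕ.+-identityʳ n)) n≤k
          ∉-∷ : ∀ {l c : Label} {ls} → c ≢ l → l ∉ ls → l ∉ c ∷ ls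
          ∉-∷ c≢l l∉ (here l≡c)  = c≢l (sym l≡c)
          ∉-∷ c≢l l∉ (there l∈)  = l∉ l∈

          answer : ∀ c → Distinct ((m , c) ∷ D) → (m ≼ z → c ≢ lz) → (y ≼ m → c ≢ ly) →
                   Wins w K X₀ ((m , c) ∷ D) Y₀
          answer c c! _ _ with c ℕ.≟ lz | c ℕ.≟ ly
          -- With `lz` spent, `ly` must be saved; it is still free because `lz≢ly`.
          ... | yes refl | _      =
            fillY n eq′ D⊂′ (≡0⇒≤ (seesZ′ c)) (n+0≤k (seesY′ c)) c! (∉-∷ lz≢ly ly∉D)
          ... | no c≢lz | yes _   =
            fillZ n eq′ D⊂′ (n+0≤k (seesZ′ c)) (≡0⇒≤ (seesY′ c)) c! (∉-∷ c≢lz lz∉D)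
          ... | no c≢lz | no c≢ly =
            fillBetween n eq′ D⊂′ (seesZ′ c) (seesY′ c) c! (∉-∷ c≢lz lz∉D) (∉-∷ c≢ly ly∉D)

      endgame : Wins w K X₀ [] Y₀
      endgame with lz ℕ.≟ ly | ≺-dense {z} {y} z≺y
      ... | yes lz≡ly | _             = fillEqual lz≡ly k (cong suc (ℕ.+-identityʳ k)) [] refl N++C! λ ()
      ... | no lz≢ly  | m , z≺m , m≺y =
        fillBetween lz≢ly m z≺m m≺y (suc k) (cong suc (ℕ.+-identityʳ k)) [] refl refl N++C! (λ ()) (λ ())

    -- The left points come first, and `z` then serves as the left end of the gap for the right
    -- points, which forces `z` before `y`.
    oddEnding : w ≡ suc (k + k) → K ≡ suc (suc k + (k + k)) → 1 ≤ k →
      ∀ {C N O} a b → Opened C N O a b → Wins w K C [] (N ++ O)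
    oddEnding w≡ K≡ 1≤k {C} {N} {O} a b st =
      extendLeft k {B = []} a b Y≤w (trans (ℕ.+-identityʳ k) (sym |N|≡k)) N+C<w gap [] Repeats-[]
        λ {z} {lz} {B} a′ a′≺z z≺b a≼a′ B≼a′ repsN lz∉C lz∉N →
          -- The repetitions left over from the opening are kept, so only the labels of `C` outside
          -- `O` can still be repeated.
          extendRight (length C ∸ length O) z b (X≤w {z , lz} B (length≤ repsN))
            (ℕ.m∸n+n≡m (length≤ reps)) N+C<w z≺b O≽b reps
            λ {y} {ly} {O′} b′ z≺y y≺b′ b′≼b O′≽b′ reps′ ly∉C ly∉N →
              Endgame.endgame w≡ K≡ 1≤k {a = a′} {b = b′} {z = z} {y = y}
                (ℕ.≤-trans (length≤ repsN) (ℕ.≤-reflexive |N|≡k)) |C|≡k |N|≡k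
                (ℕ.≤-trans (length≤ reps′) (ℕ.≤-reflexive |C|≡k))
                a′≺z z≺y y≺b′ B≼a′ (All.map (ℚ.≤-trans b′≼b) C≽b)
                (All.map (λ e≼a → ℚ.≤-trans e≼a a≼a′) N≼a) O′≽b′ new lz∉C lz∉N ly∉C ly∉N
      where
      open Opened st
      N+C<w : length N + length C < w
      N+C<w rewrite |N|≡k | |C|≡k = ℕ.≤-reflexive (sym w≡)
      Y≤w : length (N ++ O) ≤ w
      Y≤w rewrite length-++ N {O} = ℕ.≤-trans (ℕ.+-monoʳ-≤ (length N) (length≤ reps)) (ℕ.<⇒≤ N+C<w)
      X≤w : ∀ {z} B → length B ≤ length N → length ((z ∷ B) ++ C) ≤ w
      X≤w B B≤N rewrite length-++ B {C} = ℕ.≤-trans (s≤s (ℕ.+-monoˡ-≤ (length C) B≤N)) N+C<w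

-- From winning positions to the bound, by parity of the width.

Wins⇒CanForce : ∀ {w K} → Wins w K [] [] [] → CanForce w K
Wins⇒CanForce {w} {K} win = Winning⇒CanForce w K (fromℚ 0ℚ) (win (Fits-length w z≤n z≤n) ↭-refl)

offset : ∀ q → {True (0ℚ ℚ.<? q)} → {True (q ℚ.<? 1ℚ)} → Offset
offset q {0<q} {q<1} = record { value = q ; above-0 = toWitness 0<q ; below-1 = toWitness q<1 }

-- Any two distinct offsets would serve as the initial gap.
¼ ¾ : Offset
¼ = offset (+ 1 ℚ./ 4)
¾ = offset (+ 3 ℚ./ 4)

¼≺¾ : ¼ ≺ ¾
¼≺¾ = from-yes (value ¼ ℚ.<? value ¾)

canForce-even : ∀ k → CanForce (k + k) (k + (k + k))
canForce-even k = Wins⇒CanForce (opening ¼ ¾ ¼≺¾ (evenEnding refl refl))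
  where open Strategy.Opening (k + k) (k + (k + k)) k ℕ.≤-refl

canForce-odd : ∀ k → 1 ≤ k → CanForce (suc (k + k)) (suc (suc k + (k + k)))
canForce-odd k 1≤k = Wins⇒CanForce (opening ¼ ¾ ¼≺¾ (oddEnding refl refl 1≤k))
  where open Strategy.Opening (suc (k + k)) (suc (suc k + (k + k))) k (ℕ.n≤1+n _)

even⊎odd : ∀ n → ∃[ k ] (n ≡ k + k ⊎ n ≡ suc (k + k))
even⊎odd zero    = 0 , inj₁ refl
even⊎odd (suc n) with even⊎odd n
... | k , inj₁ refl = k , inj₂ refl
... | k , inj₂ refl = suc k , inj₁ (cong suc (sym (ℕ.+-suc k k)))

⌈3[k+k]/2⌉ : ∀ k → k + (k + k) ≡ ⌈ 3 * (k + k) /2⌉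
⌈3[k+k]/2⌉ k = trans (ℕ.n≡⌈n+n/2⌉ (k + (k + k))) (cong ⌈_/2⌉ (double k))
  where
  open +-*-Solver
  double : ∀ k → k + (k + k) + (k + (k + k)) ≡ 3 * (k + k)
  double = solve 1 (λ k → k :+ (k :+ k) :+ (k :+ (k :+ k)) := con 3 :* (k :+ k)) refl

⌈3[1+k+k]/2⌉ : ∀ k → suc (suc k + (k + k)) ≡ ⌈ 3 * suc (k + k) /2⌉
-- `⌈ suc n /2⌉` unfolds to `suc ⌊ n /2⌋`, which reduces the odd case to halving twice 3k + 1.
⌈3[1+k+k]/2⌉ k = trans (cong suc (ℕ.n≡⌊n+n/2⌋ (suc (k + (k + k))))) (cong ⌈_/2⌉ (double k))
  where
  open +-*-Solver
  double : ∀ k → suc (suc (k + (k + k)) + suc (k + (k + k))) ≡ 3 * suc (k + k)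
  double = solve 1 (λ k →
    con 1 :+ (con 1 :+ (k :+ (k :+ k)) :+ (con 1 :+ (k :+ (k :+ k)))) := con 3 :* (con 1 :+ (k :+ k))) refl

canForce : ∀ w → 1 < w → CanForce w ⌈ 3 * w /2⌉
canForce w 1<w with even⊎odd w
... | k     , inj₁ refl = subst (CanForce (k + k)) (⌈3[k+k]/2⌉ k) (canForce-even k)
... | zero  , inj₂ refl = contradiction 1<w (ℕ.<-irrefl refl)
... | suc j , inj₂ refl =
  subst (CanForce (suc (suc j + suc j))) (⌈3[1+k+k]/2⌉ (suc j)) (canForce-odd (suc j) (s≤s z≤n))

theorem1p1 : ∀ (w : ℕ) → 1 < w → OlwsR≥ w ⌈ 3 * w /2⌉
theorem1p1 w 1<w = (_ , canForce w 1<w , ℕ.≤-refl) , λ k (_ , maximal) → maximal _ (canForce w 1<w)
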